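{- Let $n\geq 5$ and $1\leq i\leq\lfloor n/2\rfloor$. Let $G_i$ be the graph obtained from the complete graph $K_n$ by deleting $i$ edges, each of which joins two saturated vertices (equivalently, deleting the edges of a matching of size $i$). If $g:V((G_i)_1)\to V((G_i)_2)$ is a constant function, then $$Dist(F_{G_i})=\max\{n-2i,\ \phi(i)\}.$$
   Context: A vertex of a graph is saturated if it is adjacent to all other vertices. $Dist(H)$ is the least $t$ such that $H$ has a labeling $V(H)\to\{1,\dots,t\}$ preserved by no non-identity automorphism of $H$. Functigraph: for disjoint copies $H_1,H_2$ of a graph $H$ and a function $g:V(H_1)\to V(H_2)$, $F_H$ has vertex set $V(H_1)\cup V(H_2)$ and edge set $E(H_1)\cup E(H_2)\cup\{uv: u\in V(H_1),\ g(u)=v\}$. The function $\phi:\mathbb{N}\to\mathbb{N}\setminus\{1\}$ is defined by $\phi(i)=k$, where $k$ is the least number (with $k\ge 2$) such that $i\leq\binom{k}{2}$; e.g. $\phi(32)=9$. -}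

module Defs where

open import Data.Fin using (Fin)
open import Data.Nat using (ℕ; zero; suc; _+_; _≤_; z≤n; s≤s; _≤?_)
open import Data.Nat.Combinatorics using (_C_; nC1≡n; nCk+nC[k+1]≡[n+1]C[k+1])
open import Data.Nat.Properties using (≤-trans; ≤-reflexive; m≤m+n; n≤1+n)
open import Data.Product using (∃; _×_; _,_; proj₁; swap)
open import Data.Sum using (_⊎_; inj₁; inj₂)
open import Data.Empty using (⊥-elim)
open import Function using (_∘_; _↔_; _⇔_; Inverse)
open import Relation.Binary using (Rel; Symmetric)
open import Relation.Binary.PropositionalEquality using (_≡_; _≢_; refl; sym)
open import Relation.Nullary using (¬_; yes; no)
open import Relation.Nullary.Decidable using (_×-dec_)
open import Relation.Unary using (Pred; Decidable)
open import Level using (0ℓ)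

IsLeast : ∀ {ℓ} → Pred ℕ ℓ → ℕ → Set ℓ
IsLeast P m = P m × (∀ k → P k → m ≤ k)

least : ∀ {ℓ} {P : Pred ℕ ℓ} → Decidable P → ∀ w → P w → ∃ (IsLeast P)
least P? zero    p = zero , p , λ _ _ → z≤n
least P? (suc w) p with P? zero
... | yes p₀ = zero , p₀ , λ _ _ → z≤n
... | no ¬p₀ with least (λ k → P? (suc k)) w p
...   | m , pm , min = suc m , pm , λ where
          zero    p₀ → ⊥-elim (¬p₀ p₀)
          (suc k) pk → s≤s (min k pk)

PhiBound : ℕ → Pred ℕ 0ℓ
PhiBound i k = 2 ≤ k × i ≤ k C 2

phiBound-2+ : ∀ i → PhiBound i (2 + i)
phiBound-2+ i = s≤s (s≤s z≤n) ,
  ≤-trans (n≤1+n i)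
  (≤-trans (≤-reflexive (sym (nC1≡n (suc i))))
  (≤-trans (m≤m+n (suc i C 1) (suc i C 2))
           (≤-reflexive (nCk+nC[k+1]≡[n+1]C[k+1] (suc i) 1))))

φ-least : ∀ i → ∃ (IsLeast (PhiBound i))
φ-least i = least (λ k → (2 ≤? k) ×-dec (i ≤? k C 2)) (2 + i) (phiBound-2+ i)

φ : ℕ → ℕ
φ i = proj₁ (φ-least i)

_ : φ 32 ≡ 9
_ = refl

record Graph (V : Set) : Set₁ where
  field
    Adj        : Rel V 0ℓ
    adj-sym    : Symmetric Adj
    adj-irrefl : ∀ {u} → ¬ Adj u u

open Graph public

Saturated : ∀ {V} → Graph V → V → Set
Saturated G u = ∀ w → w ≢ u → Adj G u w

complete : ∀ n → Graph (Fin n)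
complete n = record
  { Adj        = _≢_
  ; adj-sym    = λ u≢v v≡u → u≢v (sym v≡u)
  ; adj-irrefl = λ u≢u → u≢u refl
  }

SamePair : ∀ {V : Set} → V → V → V → V → Set
SamePair u v x y = (x ≡ u × y ≡ v) ⊎ (x ≡ v × y ≡ u)

samePair-swap : ∀ {V : Set} {u v x y : V} → SamePair u v x y → SamePair u v y x
samePair-swap (inj₁ p) = inj₂ (swap p)
samePair-swap (inj₂ p) = inj₁ (swap p)

deleteEdge : ∀ {V} → Graph V → V → V → Graph V
deleteEdge G u v = record
  { Adj        = λ x y → Adj G x y × ¬ SamePair u v x y
  ; adj-sym    = λ (a , ne) → adj-sym G a , ne ∘ samePair-swap
  ; adj-irrefl = λ (a , _) → adj-irrefl G a
  }

-- The edges are deleted one at a time, and the endpoints of each must be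
-- saturated in the graph that remains at that step (every vertex of the
-- initial complete graph is saturated); hence the deleted edges form a matching.
data DeletedFromComplete (n : ℕ) : ℕ → Graph (Fin n) → Set₁ where
  none   : DeletedFromComplete n 0 (complete n)
  delete : ∀ {i G} u v → DeletedFromComplete n i G →
           Adj G u v → Saturated G u → Saturated G v →
           DeletedFromComplete n (suc i) (deleteEdge G u v)

-- The two copies of the vertex set are the two summands.
functigraph : ∀ {V} → Graph V → (V → V) → Graph (V ⊎ V)
functigraph {V} H g = record
  { Adj        = A
  ; adj-sym    = λ {x} {y} → A-sym x y
  ; adj-irrefl = λ {x} → A-irrefl x
  }
  where
  A : Rel (V ⊎ V) 0ℓ
  A (inj₁ x) (inj₁ y) = Adj H x y
  A (inj₂ x) (inj₂ y) = Adj H x y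
  A (inj₁ u) (inj₂ v) = g u ≡ v
  A (inj₂ v) (inj₁ u) = g u ≡ v

  A-sym : ∀ x y → A x y → A y x
  A-sym (inj₁ _) (inj₁ _) a = adj-sym H a
  A-sym (inj₂ _) (inj₂ _) a = adj-sym H a
  A-sym (inj₁ _) (inj₂ _) e = e
  A-sym (inj₂ _) (inj₁ _) e = e

  A-irrefl : ∀ x → ¬ A x x
  A-irrefl (inj₁ _) = adj-irrefl H
  A-irrefl (inj₂ _) = adj-irrefl H

record Automorphism {V : Set} (H : Graph V) : Set where
  field
    perm     : V ↔ V
    adj-pres : ∀ x y → Adj H x y ⇔ Adj H (Inverse.to perm x) (Inverse.to perm y)

  apply : V → V
  apply = Inverse.to perm

open Automorphism public

IsIdentity : ∀ {V} {H : Graph V} → Automorphism H → Set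
IsIdentity σ = ∀ x → apply σ x ≡ x

Preserves : ∀ {V} {H : Graph V} {t} → Automorphism H → (V → Fin t) → Set
Preserves σ f = ∀ x → f (apply σ x) ≡ f x

Distinguishing : ∀ {V} (H : Graph V) {t} → (V → Fin t) → Set
Distinguishing H f = ¬ (∃ λ (σ : Automorphism H) → ¬ IsIdentity σ × Preserves σ f)

-- `Dist H t` reads "Dist(H) = t"; a least element is unique, so this relation
-- is single-valued in t.
Dist : ∀ {V} → Graph V → ℕ → Set
Dist {V} H = IsLeast (λ t → ∃ λ (f : V → Fin t) → Distinguishing H f)

Constant : ∀ {A B : Set} → (A → B) → Set
Constant g = ∃ λ c → ∀ x → g x ≡ c

{-# OPTIONS --safe #-}
module Submission where

-- The constant value c of g is the only vertex of the functigraph with at most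
-- one non-neighbour, so every automorphism fixes it, and then it preserves both
-- copies: the first copy is connected and has more vertices than the second one
-- without c. Hence it suffices that a labeling distinguishes each copy of G. An
-- automorphism of G permutes the n - 2i saturated vertices and the i deleted
-- edges, possibly reversing them, so G is distinguished once the saturated
-- vertices get distinct labels and the deleted edges distinct 2-sets of labels.
-- Conversely every automorphism of the first copy extends by the identity, so
-- two saturated vertices with one label, a deleted edge with equal labels at its
-- ends, or two deleted edges with the same label set give a non-trivial
-- automorphism that preserves the labeling.

open import Data.Bool using (Bool; true; false; not)
open import Data.Bool.Properties using (not-involutive)
open import Data.Empty using (⊥; ⊥-elim)
open import Data.Fin as Fin using (Fin; zero; suc; splitAt; _↑ˡ_; _↑ʳ_; inject≤)
import Data.Fin.Properties as Finₚ
open import Data.Nat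
  using (ℕ; zero; suc; _+_; _≤_; _∸_; _*_; _⊔_; ⌊_/2⌋; z≤n; s≤s; s<s; z<s)
open import Data.Nat.Combinatorics using (_C_; nC1≡n; nCk+nC[k+1]≡[n+1]C[k+1])
open import Data.Nat.Properties
  using (≤-trans; 1+n≰n; +-identityʳ; +-suc; *-suc; m+n∸n≡m; m≤m⊔n; m≤n⊔m; ⊔-lub)
open import Data.Product using (∃; _×_; _,_; proj₁; proj₂)
open import Data.Sum using (_⊎_; inj₁; inj₂; [_,_])
import Data.Sum as Sum
open import Data.Sum.Properties using (inj₁-injective; inj₂-injective)
open import Function using (_∘_; _↔_; _⇔_; Inverse; Equivalence; Injection; mk⇔; mk↔ₛ′)
open import Function.Construct.Composition using (_↔-∘_)
open import Function.Construct.Identity using (⇔-id)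
open import Function.Construct.Symmetry using (↔-sym)
open import Function.Definitions using (Injective)
open import Function.Properties.Inverse using (↔⇒↣)
open import Relation.Binary using (DecidableEquality)
open import Relation.Binary.PropositionalEquality
  using (_≡_; _≢_; refl; sym; trans; cong; subst; subst₂)
open import Relation.Nullary using (¬_; yes; no; contradiction)
open import Relation.Nullary.Decidable using (decidable-stable)
open import Defs

-- Numbering the 2-subsets of a set of labels

tri : ℕ → ℕ
tri zero    = 0
tri (suc t) = t + tri t

tri≡C2 : ∀ t → tri t ≡ t C 2
tri≡C2 zero    = refl
tri≡C2 (suc t) rewrite tri≡C2 t =
  trans (cong (_+ t C 2) (sym (nC1≡n t))) (nCk+nC[k+1]≡[n+1]C[k+1] t 1)

-- The first `t` indices stand for the pairs that contain `zero`, the remaining ones recursively for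
-- pairs of successors; `false` selects the smaller end.
endpoint : ∀ t → Fin (tri t) → Bool → Fin t
endpoint (suc t) k b with splitAt t k | b
... | inj₁ j | false = zero
... | inj₁ j | true  = suc j
... | inj₂ l | b     = suc (endpoint t l b)

endpoint-< : ∀ t k → endpoint t k false Fin.< endpoint t k true
endpoint-< (suc t) k with splitAt t k
... | inj₁ j = z<s
... | inj₂ l = s<s (endpoint-< t l)

endpoint-injective : ∀ t k l → endpoint t k false ≡ endpoint t l false →
                     endpoint t k true ≡ endpoint t l true → k ≡ l
endpoint-injective (suc t) k l eq₀ eq₁ with splitAt t k in eqk | splitAt t l in eql
... | inj₁ i | inj₁ j =
      trans (sym (Finₚ.splitAt⁻¹-↑ˡ eqk))
            (trans (cong (_↑ˡ tri t) (Finₚ.suc-injective eq₁)) (Finₚ.splitAt⁻¹-↑ˡ eql))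
... | inj₁ _ | inj₂ _ = contradiction eq₀ λ()
... | inj₂ _ | inj₁ _ = contradiction eq₀ λ()
... | inj₂ i | inj₂ j =
      trans (sym (Finₚ.splitAt⁻¹-↑ʳ eqk))
            (trans (cong (t ↑ʳ_) (endpoint-injective t i j
                     (Finₚ.suc-injective eq₀) (Finₚ.suc-injective eq₁)))
                   (Finₚ.splitAt⁻¹-↑ʳ eql))

-- Follows the numbering of `endpoint`. Both orders of a pair get the same index, so an index
-- determines an unordered pair.
pairIndex : ∀ {t} (a b : Fin t) → a ≢ b → Fin (tri t)
pairIndex zero    zero    a≢b = contradiction refl a≢b
pairIndex {suc t} zero    (suc b) _   = b ↑ˡ tri t
pairIndex {suc t} (suc a) zero    _   = a ↑ˡ tri t
pairIndex {suc t} (suc a) (suc b) a≢b = t ↑ʳ pairIndex a b (a≢b ∘ cong suc)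

↑ˡ≢↑ʳ : ∀ {m n} (i : Fin m) (j : Fin n) → i ↑ˡ n ≢ m ↑ʳ j
↑ˡ≢↑ʳ {m} {n} i j eq
  with () ← trans (sym (Finₚ.splitAt-↑ˡ m i n)) (trans (cong (splitAt m) eq) (Finₚ.splitAt-↑ʳ m n j))

pairIndex-injective : ∀ {t} (a b c d : Fin t) (a≢b : a ≢ b) (c≢d : c ≢ d) →
                      pairIndex a b a≢b ≡ pairIndex c d c≢d → SamePair a b c d
pairIndex-injective zero zero _ _ a≢b _ _ = contradiction refl a≢b
pairIndex-injective zero (suc _) zero zero _ c≢d _ = contradiction refl c≢d
pairIndex-injective (suc _) _ zero zero _ c≢d _ = contradiction refl c≢d
pairIndex-injective zero (suc b) zero (suc d) _ _ eq =
  inj₁ (refl , cong suc (Finₚ.↑ˡ-injective _ d b (sym eq)))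
pairIndex-injective zero (suc b) (suc c) zero _ _ eq =
  inj₂ (cong suc (Finₚ.↑ˡ-injective _ c b (sym eq)) , refl)
pairIndex-injective zero (suc b) (suc c) (suc d) _ _ eq = contradiction eq (↑ˡ≢↑ʳ b _)
pairIndex-injective (suc a) zero zero (suc d) _ _ eq =
  inj₂ (refl , cong suc (Finₚ.↑ˡ-injective _ d a (sym eq)))
pairIndex-injective (suc a) zero (suc c) zero _ _ eq =
  inj₁ (cong suc (Finₚ.↑ˡ-injective _ c a (sym eq)) , refl)
pairIndex-injective (suc a) zero (suc c) (suc d) _ _ eq = contradiction eq (↑ˡ≢↑ʳ a _)
pairIndex-injective (suc a) (suc b) zero (suc d) _ _ eq = contradiction (sym eq) (↑ˡ≢↑ʳ d _)
pairIndex-injective (suc a) (suc b) (suc c) zero _ _ eq = contradiction (sym eq) (↑ˡ≢↑ʳ c _)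
pairIndex-injective {suc t} (suc a) (suc b) (suc c) (suc d) _ _ eq
  with pairIndex-injective a b c d _ _ (Finₚ.↑ʳ-injective t _ _ eq)
... | inj₁ (p , q) = inj₁ (cong suc p , cong suc q)
... | inj₂ (p , q) = inj₂ (cong suc p , cong suc q)

-- Fresh vertices; inverses and restrictions of automorphisms

fresh : ∀ {n} → 3 ≤ n → (p q : Fin n) → ∃ λ w → w ≢ p × w ≢ q
fresh (s≤s (s≤s (s≤s _))) (suc _)       (suc _)       = zero , (λ ()) , λ ()
fresh (s≤s (s≤s (s≤s _))) zero          zero          = suc zero , (λ ()) , λ ()
fresh (s≤s (s≤s (s≤s _))) zero          (suc zero)    = suc (suc zero) , (λ ()) , λ ()
fresh (s≤s (s≤s (s≤s _))) zero          (suc (suc _)) = suc zero , (λ ()) , λ ()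
fresh (s≤s (s≤s (s≤s _))) (suc zero)    zero          = suc (suc zero) , (λ ()) , λ ()
fresh (s≤s (s≤s (s≤s _))) (suc (suc _)) zero          = suc zero , (λ ()) , λ ()

↔-injective : ∀ {A B : Set} (π : A ↔ B) → Injective _≡_ _≡_ (Inverse.to π)
↔-injective π = Injection.injective (↔⇒↣ π)

inverse : ∀ {V} {H : Graph V} → Automorphism H → Automorphism H
inverse {H = H} σ = record
  { perm     = ↔-sym (perm σ)
  ; adj-pres = λ x y → mk⇔
      (λ a → Equivalence.from (adj-pres σ _ _)
        (subst₂ (Adj H) (sym (strictlyInverseˡ x)) (sym (strictlyInverseˡ y)) a))
      (λ a → subst₂ (Adj H) (strictlyInverseˡ x) (strictlyInverseˡ y)
        (Equivalence.to (adj-pres σ _ _) a))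
  }
  where open Inverse (perm σ) using (strictlyInverseˡ)

-- Here `ι` embeds `K` as an induced subgraph. Asking that the inverse of `σ` also maps the image
-- into itself makes the restricted map a bijection without counting.
module Restriction {W V} {K : Graph W} {H : Graph V} (ι : W → V) (ι-injective : Injective _≡_ _≡_ ι)
    (ι-adj : ∀ x y → Adj K x y ⇔ Adj H (ι x) (ι y)) (σ : Automorphism H)
    (into   : ∀ w → ∃ λ w′ → apply σ (ι w) ≡ ι w′)
    (into⁻¹ : ∀ w → ∃ λ w′ → apply (inverse σ) (ι w) ≡ ι w′) where

  restriction : Automorphism K
  restriction = record
    { perm = mk↔ₛ′ (proj₁ ∘ into) (proj₁ ∘ into⁻¹)
        (λ w → ι-injective (trans (sym (proj₂ (into _)))
          (trans (cong (apply σ) (sym (proj₂ (into⁻¹ w)))) (Inverse.strictlyInverseˡ (perm σ) (ι w)))))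
        (λ w → ι-injective (trans (sym (proj₂ (into⁻¹ _)))
          (trans (cong (apply (inverse σ)) (sym (proj₂ (into w)))) (Inverse.strictlyInverseʳ (perm σ) (ι w)))))
    ; adj-pres = λ x y → mk⇔
        (λ a → Equivalence.from (ι-adj _ _) (subst₂ (Adj H) (proj₂ (into x)) (proj₂ (into y))
          (Equivalence.to (adj-pres σ _ _) (Equivalence.to (ι-adj x y) a))))
        (λ a → Equivalence.from (ι-adj x y) (Equivalence.from (adj-pres σ _ _)
          (subst₂ (Adj H) (sym (proj₂ (into x))) (sym (proj₂ (into y))) (Equivalence.to (ι-adj _ _) a))))
    }

-- An exchange that commutes with a given involution

-- The involution exchanging x with y and m x with m y; it also covers the
-- degenerate cases y ≡ m x and m x ≡ x.
module Exchange {V : Set} (_≟_ : DecidableEquality V) (m : V → V) (m-involutive : ∀ v → m (m v) ≡ v)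
    (x y : V) (fixed-x⇒y : m x ≡ x → m y ≡ y) (fixed-y⇒x : m y ≡ y → m x ≡ x) where

  exchange : V → V
  exchange z with z ≟ x | z ≟ y | z ≟ m x | z ≟ m y
  ... | yes _ | _     | _     | _     = y
  ... | no _  | yes _ | _     | _     = x
  ... | no _  | no _  | yes _ | _     = m y
  ... | no _  | no _  | no _  | yes _ = m x
  ... | no _  | no _  | no _  | no _  = z

  exchange-x : exchange x ≡ y
  exchange-x with x ≟ x
  ... | yes _  = refl
  ... | no x≢x = contradiction refl x≢x

  exchange-y : exchange y ≡ x
  exchange-y with y ≟ x | y ≟ y
  ... | yes y≡x | _      = y≡x
  ... | no _    | yes _  = refl
  ... | no _    | no y≢y = contradiction refl y≢y

  -- If `m x` coincides with `x` or `y`, an earlier clause of `exchange` fires. The value is still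
  -- `m y`: in the first case `y` is fixed by `m` too, in the second `m y` is `x`.
  exchange-mx : exchange (m x) ≡ m y
  exchange-mx with m x ≟ x | m x ≟ y | m x ≟ m x
  ... | yes p | _     | _     = sym (fixed-x⇒y p)
  ... | no _  | yes p | _     = trans (sym (m-involutive x)) (cong m p)
  ... | no _  | no _  | yes _ = refl
  ... | no _  | no _  | no ¬p = contradiction refl ¬p

  exchange-my : exchange (m y) ≡ m x
  exchange-my with m y ≟ x | m y ≟ y | m y ≟ m x | m y ≟ m y
  ... | yes p | _     | _     | _     = trans (sym (m-involutive y)) (cong m p)
  ... | no _  | yes p | _     | _     = sym (fixed-y⇒x p)
  ... | no _  | no _  | yes p | _     = p
  ... | no _  | no _  | no _  | yes _ = refl
  ... | no _  | no _  | no _  | no ¬p = contradiction refl ¬p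

  exchange-other : ∀ {z} → z ≢ x → z ≢ y → z ≢ m x → z ≢ m y → exchange z ≡ z
  exchange-other {z} z≢x z≢y z≢mx z≢my with z ≟ x | z ≟ y | z ≟ m x | z ≟ m y
  ... | yes p | _     | _     | _     = contradiction p z≢x
  ... | no _  | yes p | _     | _     = contradiction p z≢y
  ... | no _  | no _  | yes p | _     = contradiction p z≢mx
  ... | no _  | no _  | no _  | yes p = contradiction p z≢my
  ... | no _  | no _  | no _  | no _  = refl

  data Position : V → Set where
    at-x  : Position x
    at-y  : Position y
    at-mx : Position (m x)
    at-my : Position (m y)
    other : ∀ {z} → z ≢ x → z ≢ y → z ≢ m x → z ≢ m y → Position z

  position : ∀ z → Position z
  position z with z ≟ x | z ≟ y | z ≟ m x | z ≟ m y
  ... | yes refl | _        | _        | _        = at-x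
  ... | no _     | yes refl | _        | _        = at-y
  ... | no _     | no _     | yes refl | _        = at-mx
  ... | no _     | no _     | no _     | yes refl = at-my
  ... | no p     | no q     | no r     | no s     = other p q r s

  exchange-involutive : ∀ z → exchange (exchange z) ≡ z
  exchange-involutive z with position z
  ... | at-x  = trans (cong exchange exchange-x) exchange-y
  ... | at-y  = trans (cong exchange exchange-y) exchange-x
  ... | at-mx = trans (cong exchange exchange-mx) exchange-my
  ... | at-my = trans (cong exchange exchange-my) exchange-mx
  ... | other p q r s = trans (cong exchange fixed) fixed
    where fixed = exchange-other p q r s

  exchange-m : ∀ z → exchange (m z) ≡ m (exchange z)
  exchange-m z with position z
  ... | at-x  = trans exchange-mx (cong m (sym exchange-x))
  ... | at-y  = trans exchange-my (cong m (sym exchange-y))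
  ... | at-mx = trans (cong exchange (m-involutive x))
                  (trans exchange-x (trans (sym (m-involutive y)) (cong m (sym exchange-mx))))
  ... | at-my = trans (cong exchange (m-involutive y))
                  (trans exchange-y (trans (sym (m-involutive x)) (cong m (sym exchange-my))))
  ... | other p q r s =
        -- `m` permutes the four exceptional points, so `m z` lies outside them together with `z`.
        trans (exchange-other (r ∘ flip-m) (s ∘ flip-m) (p ∘ cancel-m) (q ∘ cancel-m))
              (cong m (sym (exchange-other p q r s)))
    where
    flip-m : ∀ {w} → m z ≡ w → z ≡ m w
    flip-m eq = trans (sym (m-involutive z)) (cong m eq)

    cancel-m : ∀ {w} → m z ≡ m w → z ≡ w
    cancel-m eq = trans (flip-m eq) (m-involutive _)

  exchange-preserves : ∀ {B : Set} (h : V → B) → h x ≡ h y → h (m x) ≡ h (m y) →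
                       ∀ z → h (exchange z) ≡ h z
  exchange-preserves h hx hm z with position z
  ... | at-x  = trans (cong h exchange-x) (sym hx)
  ... | at-y  = trans (cong h exchange-y) hx
  ... | at-mx = trans (cong h exchange-mx) (sym hm)
  ... | at-my = trans (cong h exchange-my) hm
  ... | other p q r s = cong h (exchange-other p q r s)

-- Coordinates on a complete graph minus a matching

-- Complete graph minus a matching: inj₁ (k , b) is an end of the k-th deleted
-- edge, inj₂ s is the s-th saturated vertex.
Slot : ℕ → ℕ → Set
Slot i r = (Fin i × Bool) ⊎ Fin r

mate : ∀ {i r} → Slot i r → Slot i r
mate (inj₁ (k , b)) = inj₁ (k , not b)
mate (inj₂ s)       = inj₂ s

mate-involutive : ∀ {i r} (w : Slot i r) → mate (mate w) ≡ w
mate-involutive (inj₁ (k , b)) = cong (λ b → inj₁ (k , b)) (not-involutive b)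
mate-involutive (inj₂ s)       = refl

-- Distinct vertices are non-adjacent exactly when their slots are mates. A free slot is its own
-- mate, so its vertex is saturated.
record Coordinates {n} (G : Graph (Fin n)) (i r : ℕ) : Set where
  field
    code      : Fin n ↔ Slot i r
    adjacency : ∀ x y → Adj G x y ⇔ (x ≢ y × Inverse.to code y ≢ mate (Inverse.to code x))

  slot : Fin n → Slot i r
  slot = Inverse.to code

  vertex : Slot i r → Fin n
  vertex = Inverse.from code

  slot-vertex : ∀ w → slot (vertex w) ≡ w
  slot-vertex = Inverse.strictlyInverseˡ code

  vertex-slot : ∀ x → vertex (slot x) ≡ x
  vertex-slot = Inverse.strictlyInverseʳ code

  slot-injective : Injective _≡_ _≡_ slot
  slot-injective = ↔-injective code

  vertex-injective : Injective _≡_ _≡_ vertex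
  vertex-injective = ↔-injective (↔-sym code)

  -- The other end of the deleted edge at `x`, or `x` itself when `x` is saturated.
  partner : Fin n → Fin n
  partner x = vertex (mate (slot x))

  slot-partner : ∀ x → slot (partner x) ≡ mate (slot x)
  slot-partner x = slot-vertex _

  partner-vertex : ∀ w → partner (vertex w) ≡ vertex (mate w)
  partner-vertex w = cong (vertex ∘ mate) (slot-vertex w)

  partner-involutive : ∀ x → partner (partner x) ≡ x
  partner-involutive x =
    slot-injective (trans (slot-partner _) (trans (cong mate (slot-partner x)) (mate-involutive _)))

  adjacent : ∀ {x y} → x ≢ y → y ≢ partner x → Adj G x y
  adjacent {x} {y} x≢y y≢px = Equivalence.from (adjacency x y)
    (x≢y , λ eq → y≢px (trans (sym (vertex-slot y)) (cong vertex eq)))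

  nonadjacent : ∀ {x} → ¬ Adj G x (partner x)
  nonadjacent {x} a = proj₂ (Equivalence.to (adjacency x _) a) (slot-partner x)

  nonneighbour : ∀ {x y} → x ≢ y → ¬ Adj G x y → y ≡ partner x
  nonneighbour {x} {y} x≢y ¬a =
    decidable-stable (y Finₚ.≟ partner x) λ y≢px → ¬a (adjacent x≢y y≢px)

  saturated⇒fixed : ∀ {u} → Saturated G u → partner u ≡ u
  saturated⇒fixed {u} sat =
    decidable-stable (partner u Finₚ.≟ u) λ pu≢u → nonadjacent (sat _ pu≢u)

  fixed⇒free : ∀ {u} → partner u ≡ u → ∃ λ s → slot u ≡ inj₂ s
  fixed⇒free {u} pu≡u = free (slot u) refl (trans (sym (slot-partner u)) (cong slot pu≡u))
    where
    free : ∀ w → slot u ≡ w → mate (slot u) ≡ slot u → ∃ λ s → slot u ≡ inj₂ s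
    free (inj₂ s)           eq _ = s , eq
    free (inj₁ (k , false)) eq p rewrite eq with () ← p
    free (inj₁ (k , true))  eq p rewrite eq with () ← p

  -- Adjacency is determined by equality and `partner`, and `ρ` respects both.
  partner-automorphism : (ρ : Fin n ↔ Fin n) → let open Inverse ρ in
                         (∀ x → to (partner x) ≡ partner (to x)) → Automorphism G
  partner-automorphism ρ comm = record
    { perm     = ρ
    ; adj-pres = λ x y → mk⇔
        (λ a → adjacent
          (λ eq → adj-irrefl G (subst (Adj G x) (sym (↔-injective ρ eq)) a))
          (λ eq → nonadjacent (subst (Adj G x) (↔-injective ρ (trans eq (sym (comm x)))) a)))
        (λ a → adjacent
          (λ { refl → adj-irrefl G a })
          (λ { refl → nonadjacent (subst (Adj G _) (comm x) a) }))
    }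

  -- A partner other than `x` is its only non-neighbour, which `τ` must carry to that of the image.
  -- If `x` is its own partner it is saturated, and so is its image.
  automorphism-partner : (τ : Automorphism G) → ∀ x → apply τ (partner x) ≡ partner (apply τ x)
  automorphism-partner τ x with partner x Finₚ.≟ x
  ... | no px≢x = nonneighbour
        (λ eq → px≢x (sym (↔-injective (perm τ) eq)))
        (nonadjacent ∘ Equivalence.from (adj-pres τ x _))
  ... | yes px≡x = trans (cong (apply τ) px≡x) (sym (saturated⇒fixed saturated))
    where
    saturated : Saturated G (apply τ x)
    saturated w w≢τx = subst (Adj G (apply τ x)) (strictlyInverseˡ w)
      (Equivalence.to (adj-pres τ x _) (adjacent (w′≢x ∘ sym) (λ eq → w′≢x (trans eq px≡x))))
      where
      open Inverse (perm τ) using (from; strictlyInverseˡ)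

      w′≢x : from w ≢ x
      w′≢x eq = w≢τx (trans (sym (strictlyInverseˡ w)) (cong (apply τ) eq))

  exchangeAutomorphism : ∀ x y → (partner x ≡ x → partner y ≡ y) → (partner y ≡ y → partner x ≡ x) →
                         Automorphism G
  exchangeAutomorphism x y f g =
    partner-automorphism (mk↔ₛ′ exchange exchange exchange-involutive exchange-involutive) exchange-m
    where open Exchange Finₚ._≟_ partner partner-involutive x y f g

  -- Serves to move chosen saturated vertices into prescribed free slots.
  precompose : Automorphism G → Coordinates G i r
  precompose τ = record
    { code      = code ↔-∘ perm τ
    ; adjacency = λ x y → mk⇔
        (λ a → (λ { refl → adj-irrefl G a }) ,
               proj₂ (Equivalence.to (adjacency _ _) (Equivalence.to (adj-pres τ x y) a)))
        (λ (x≢y , ne) → Equivalence.from (adj-pres τ x y)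
          (Equivalence.from (adjacency _ _) (x≢y ∘ ↔-injective (perm τ) , ne)))
    }

  module FixedExchange {x y} (px≡x : partner x ≡ x) (py≡y : partner y ≡ y) where

    open Exchange Finₚ._≟_ partner partner-involutive x y (λ _ → py≡y) (λ _ → px≡x) public

    recoded : Coordinates G i r
    recoded = precompose (exchangeAutomorphism x y (λ _ → py≡y) (λ _ → px≡x))

-- Coordinates carried along the deletion of edges

completeCoordinates : ∀ n → Coordinates (complete n) 0 n
completeCoordinates n = record
  { code      = mk↔ₛ′ inj₂ (λ { (inj₁ (() , _)) ; (inj₂ s) → s })
                  (λ { (inj₁ (() , _)) ; (inj₂ _) → refl }) (λ _ → refl)
  ; adjacency = λ x y → mk⇔ (λ x≢y → x≢y , λ eq → x≢y (sym (inj₂-injective eq))) proj₁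
  }

join : ∀ {i r} → Slot i (2 + r) → Slot (suc i) r
join (inj₁ (k , b))       = inj₁ (suc k , b)
join (inj₂ zero)          = inj₁ (zero , false)
join (inj₂ (suc zero))    = inj₁ (zero , true)
join (inj₂ (suc (suc s))) = inj₂ s

unjoin : ∀ {i r} → Slot (suc i) r → Slot i (2 + r)
unjoin (inj₁ (suc k , b))    = inj₁ (k , b)
unjoin (inj₁ (zero , false)) = inj₂ zero
unjoin (inj₁ (zero , true))  = inj₂ (suc zero)
unjoin (inj₂ s)              = inj₂ (suc (suc s))

join↔ : ∀ {i r} → Slot i (2 + r) ↔ Slot (suc i) r
join↔ = mk↔ₛ′ join unjoin
  (λ { (inj₁ (suc _ , _)) → refl ; (inj₁ (zero , false)) → refl
     ; (inj₁ (zero , true)) → refl ; (inj₂ _) → refl })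
  (λ { (inj₁ _) → refl ; (inj₂ zero) → refl ; (inj₂ (suc zero)) → refl ; (inj₂ (suc (suc _))) → refl })

-- `join` commutes with `mate` except on the two slots that become the ends of the new deleted edge.
join-mate⁻¹ : ∀ {i r} (w z : Slot i (2 + r)) → join z ≡ mate (join w) →
              z ≡ mate w ⊎ SamePair (inj₂ zero) (inj₂ (suc zero)) w z
join-mate⁻¹ (inj₁ _) z eq = inj₁ (↔-injective join↔ eq)
join-mate⁻¹ (inj₂ zero) z eq = inj₂ (inj₁ (refl , ↔-injective join↔ eq))
join-mate⁻¹ (inj₂ (suc zero)) z eq = inj₂ (inj₂ (refl , ↔-injective join↔ eq))
join-mate⁻¹ (inj₂ (suc (suc _))) z eq = inj₁ (↔-injective join↔ eq)

deletedCoordinates : ∀ {n i r} {G : Graph (Fin n)} (M : Coordinates G i (2 + r)) (u v : Fin n) →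
  Coordinates.slot M u ≡ inj₂ zero → Coordinates.slot M v ≡ inj₂ (suc zero) →
  Coordinates (deleteEdge G u v) (suc i) r
deletedCoordinates {G = G} M u v eqᵤ eqᵥ = record
  { code      = join↔ ↔-∘ code
  ; adjacency = λ x y → mk⇔
      (λ (a , ¬same) → proj₁ (Equivalence.to (adjacency x y) a) , ends x y a ¬same)
      (λ (x≢y , ne) → Equivalence.from (adjacency x y) (x≢y , x≢y ∘ mates x y ne) , notSame x y ne)
  }
  where
  open Coordinates M

  ends : ∀ x y → Adj G x y → ¬ SamePair u v x y → join (slot y) ≢ mate (join (slot x))
  ends x y a ¬same eq with join-mate⁻¹ (slot x) (slot y) eq
  ... | inj₁ mates            = proj₂ (Equivalence.to (adjacency x y) a) mates
  ... | inj₂ (inj₁ (xu , yv)) =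
        ¬same (inj₁ (slot-injective (trans xu (sym eqᵤ)) , slot-injective (trans yv (sym eqᵥ))))
  ... | inj₂ (inj₂ (xv , yu)) =
        ¬same (inj₂ (slot-injective (trans xv (sym eqᵥ)) , slot-injective (trans yu (sym eqᵤ))))

  mates : ∀ x y → join (slot y) ≢ mate (join (slot x)) → slot y ≡ mate (slot x) → x ≡ y
  mates x y ne eq = slot-injective (cases (slot x) (slot y) ne eq)
    where
    cases : ∀ w z → join z ≢ mate (join w) → z ≡ mate w → w ≡ z
    cases (inj₁ _) _ ne refl = contradiction refl ne
    cases (inj₂ _) _ _  refl = refl

  notSame : ∀ x y → join (slot y) ≢ mate (join (slot x)) → ¬ SamePair u v x y
  notSame x y ne (inj₁ (refl , refl)) rewrite eqᵤ | eqᵥ = ne refl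
  notSame x y ne (inj₂ (refl , refl)) rewrite eqᵤ | eqᵥ = ne refl

deleteEdgeCoordinates : ∀ {n i r} {G : Graph (Fin n)} → Coordinates G i r → ∀ {u v} →
  Adj G u v → Saturated G u → Saturated G v →
  ∃ λ r′ → r ≡ 2 + r′ × Coordinates (deleteEdge G u v) (suc i) r′
-- The slots of `u` and `v` are distinct and free, so `r` is at least 2.
deleteEdgeCoordinates {i = i} {r} {G} M {u} {v} a satᵤ satᵥ =
  split r refl (proj₁ freeᵤ) (proj₁ freeᵥ) λ eq → u≢v (slot-injective
    (trans (proj₂ freeᵤ) (trans (cong inj₂ eq) (sym (proj₂ freeᵥ)))))
  where
  open Coordinates M
  freeᵤ = fixed⇒free (saturated⇒fixed satᵤ)
  freeᵥ = fixed⇒free (saturated⇒fixed satᵥ)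

  u≢v : u ≢ v
  u≢v refl = adj-irrefl G a

  -- One exchange brings `u` to the first free slot, another brings `v` to the second. The latter
  -- leaves `u` alone, since `u` is neither `v` nor the vertex in the second slot.
  recode : ∀ {r} → Coordinates G i (2 + r) → Coordinates (deleteEdge G u v) (suc i) r
  recode {r} M₀ = deletedCoordinates S₁.recoded u v u↦0₂ v↦1
    where
    module M₀ = Coordinates M₀
    module S₀ = M₀.FixedExchange (M₀.saturated⇒fixed satᵤ) (M₀.partner-vertex (inj₂ zero))
    module M₁ = Coordinates S₀.recoded
    module S₁ = M₁.FixedExchange (M₁.saturated⇒fixed satᵥ) (M₁.partner-vertex (inj₂ (suc zero)))
    open Coordinates S₁.recoded using () renaming (slot to slot₂)

    u↦0 : M₁.slot u ≡ inj₂ zero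
    u↦0 = trans (cong M₀.slot S₀.exchange-x) (M₀.slot-vertex _)

    v↦1 : slot₂ v ≡ inj₂ (suc zero)
    v↦1 = trans (cong M₁.slot S₁.exchange-x) (M₁.slot-vertex _)

    u≢₁ : u ≢ M₁.vertex (inj₂ (suc zero))
    u≢₁ eq with () ← trans (sym u↦0) (trans (cong M₁.slot eq) (M₁.slot-vertex _))

    u↦0₂ : slot₂ u ≡ inj₂ zero
    u↦0₂ = trans (cong M₁.slot (S₁.exchange-other u≢v u≢₁
      (λ eq → u≢v (trans eq (M₁.saturated⇒fixed satᵥ)))
      (λ eq → u≢₁ (trans eq (M₁.partner-vertex _))))) u↦0

  split : ∀ r₀ → r ≡ r₀ → (s s′ : Fin r₀) → s ≢ s′ →
          ∃ λ r′ → r₀ ≡ 2 + r′ × Coordinates (deleteEdge G u v) (suc i) r′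
  split (suc zero)    _    zero zero s≢s′ = contradiction refl s≢s′
  split (suc (suc r′)) refl _    _    _    = r′ , refl , recode M

coordinates : ∀ {n i G} → DeletedFromComplete n i G → ∃ λ r → r + 2 * i ≡ n × Coordinates G i r
coordinates none = _ , +-identityʳ _ , completeCoordinates _
coordinates (delete {i} u v d a satᵤ satᵥ) with coordinates d
... | r , count , M with deleteEdgeCoordinates M a satᵤ satᵥ
...   | r′ , refl , M′ = r′ , trans (trans (cong (r′ +_) (*-suc 2 i)) (trans (+-suc r′ _) (cong suc (+-suc r′ _)))) count
                      , M′

-- Vertices with at most one non-neighbour

AlmostDominating : ∀ {V} → Graph V → V → Set
AlmostDominating H x = ∀ {y z} → y ≢ x → z ≢ x → ¬ Adj H x y → ¬ Adj H x z → y ≡ z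

almostDominating-apply : ∀ {V} {H : Graph V} (σ : Automorphism H) {x} →
                         AlmostDominating H x → AlmostDominating H (apply σ x)
almostDominating-apply {H = H} σ {x} dom y≢ z≢ ¬ay ¬az =
  ↔-injective (perm (inverse σ)) (dom (distinct y≢) (distinct z≢) (nonadj ¬ay) (nonadj ¬az))
  where
  open Inverse (perm σ) using (from; strictlyInverseˡ)

  distinct : ∀ {y} → y ≢ apply σ x → from y ≢ x
  distinct y≢ eq = y≢ (trans (sym (strictlyInverseˡ _)) (cong (apply σ) eq))

  nonadj : ∀ {y} → ¬ Adj H (apply σ x) y → ¬ Adj H x (from y)
  nonadj ¬a a = ¬a (subst (Adj H (apply σ x)) (strictlyInverseˡ _) (Equivalence.to (adj-pres σ x _) a))

-- The functigraph of a constant function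

module ConstantFunctigraph {n i r} {G : Graph (Fin n)} (M : Coordinates G i r)
    (g : Fin n → Fin n) (c : Fin n) (g≡c : ∀ x → g x ≡ c) where

  open Coordinates M

  F : Graph (Fin n ⊎ Fin n)
  F = functigraph G g

  extend : Automorphism G → Automorphism F
  extend τ = record
    { perm = mk↔ₛ′ (Sum.map₁ (apply τ)) (Sum.map₁ (apply (inverse τ)))
        [ cong inj₁ ∘ Inverse.strictlyInverseˡ (perm τ) , (λ _ → refl) ]
        [ cong inj₁ ∘ Inverse.strictlyInverseʳ (perm τ) , (λ _ → refl) ]
    ; adj-pres = λ where
        (inj₁ x) (inj₁ y) → adj-pres τ x y
        -- All vertices of the first copy are joined to the same vertex `c`, so permuting them keeps
        -- the edges between the copies.
        (inj₁ x) (inj₂ y) → mk⇔ (trans (trans (g≡c _) (sym (g≡c x)))) (trans (trans (g≡c x) (sym (g≡c _))))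
        (inj₂ x) (inj₁ y) → mk⇔ (trans (trans (g≡c _) (sym (g≡c y)))) (trans (trans (g≡c y) (sym (g≡c _))))
        (inj₂ x) (inj₂ y) → ⇔-id _
    }

  -- Lower bound: labels forced by exchanges in the first copy

  module LowerBound {k} (f : Fin n ⊎ Fin n → Fin k) (dist : Distinguishing F f) where

    -- Otherwise the exchange, extended by the identity on the second copy, would preserve `f` while
    -- moving `x` to `y`.
    no-exchange : ∀ {x y} → x ≢ y → (partner x ≡ x → partner y ≡ y) → (partner y ≡ y → partner x ≡ x) →
                  f (inj₁ x) ≡ f (inj₁ y) → f (inj₁ (partner x)) ≢ f (inj₁ (partner y))
    no-exchange {x} {y} x≢y fx fy hx hm = dist
      ( extend (exchangeAutomorphism x y fx fy)
      , (λ isId → x≢y (inj₁-injective (trans (sym (isId (inj₁ x))) (cong inj₁ exchange-x))))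
      , [ exchange-preserves (f ∘ inj₁) hx hm , (λ _ → refl) ] )
      where open Exchange Finₚ._≟_ partner partner-involutive x y fx fy

    free≤ : r ≤ k
    free≤ = Finₚ.injective⇒≤ {f = λ s → f (inj₁ (vertex (inj₂ s)))} λ {s} {s′} eq →
      decidable-stable (s Finₚ.≟ s′) λ s≢s′ → no-exchange
        (s≢s′ ∘ inj₂-injective ∘ vertex-injective)
        (λ _ → partner-vertex _) (λ _ → partner-vertex _) eq
        (trans (cong (f ∘ inj₁) (partner-vertex _)) (trans eq (cong (f ∘ inj₁) (sym (partner-vertex _)))))

    end : Fin i → Bool → Fin n
    end j b = vertex (inj₁ (j , b))

    end-moved : ∀ j b → partner (end j b) ≢ end j b
    end-moved j false eq with () ← vertex-injective (trans (sym (partner-vertex _)) eq)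
    end-moved j true  eq with () ← vertex-injective (trans (sym (partner-vertex _)) eq)

    -- Covers the reversal of one deleted edge (`l` is `j` and `d` is `not b`) as well as the
    -- exchange of two deleted edges in either orientation.
    no-end-exchange : ∀ {j b l d} → inj₁ (j , b) ≢ inj₁ (l , d) → f (inj₁ (end j b)) ≡ f (inj₁ (end l d)) →
                      f (inj₁ (end j (not b))) ≢ f (inj₁ (end l (not d)))
    no-end-exchange {j} {b} {l} {d} ne eq eq′ = no-exchange (ne ∘ vertex-injective)
      (λ fixed → contradiction fixed (end-moved j b)) (λ fixed → contradiction fixed (end-moved l d)) eq
      (trans (cong (f ∘ inj₁) (partner-vertex _)) (trans eq′ (cong (f ∘ inj₁) (sym (partner-vertex _)))))

    ends-differ : ∀ j → f (inj₁ (end j false)) ≢ f (inj₁ (end j true))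
    ends-differ j eq = no-end-exchange (λ ()) eq (sym eq)

    pairs≤ : i ≤ tri k
    pairs≤ = Finₚ.injective⇒≤ {f = λ j → pairIndex _ _ (ends-differ j)} λ {j} {l} eq →
      decidable-stable (j Finₚ.≟ l) λ j≢l →
        clash j≢l (pairIndex-injective _ _ _ _ (ends-differ j) (ends-differ l) eq)
      where
      clash : ∀ {j l} → j ≢ l → ¬ SamePair (f (inj₁ (end j false))) (f (inj₁ (end j true)))
                                          (f (inj₁ (end l false))) (f (inj₁ (end l true)))
      clash j≢l (inj₁ (p , q)) = no-end-exchange (λ { refl → j≢l refl }) (sym p) (sym q)
      clash j≢l (inj₂ (p , q)) = no-end-exchange (λ ()) (sym q) (sym p)

  -- Upper bound: a distinguishing labeling

  module UpperBound (3≤n : 3 ≤ n) {p t} (i≤pairs : i ≤ tri p) (p≤t : p ≤ t) (r≤t : r ≤ t) where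

    -- The first `p` labels already offer distinct 2-subsets for the `i` deleted edges; `t` is also
    -- large enough for distinct labels on the free slots.
    slotLabel : Slot i r → Fin t
    slotLabel (inj₁ (k , b)) = inject≤ (endpoint p (inject≤ k i≤pairs) b) p≤t
    slotLabel (inj₂ s)       = inject≤ s r≤t

    label : Fin n → Fin t
    label = slotLabel ∘ slot

    -- Here `z` is to be the slot of the image of the vertex in slot `w`. The two implications keep
    -- free slots and ends of deleted edges apart.
    slotLabel-rigid : ∀ (w z : Slot i r) → (mate w ≡ w → mate z ≡ z) → (mate z ≡ z → mate w ≡ w) →
                      slotLabel z ≡ slotLabel w → slotLabel (mate z) ≡ slotLabel (mate w) → z ≡ w
    slotLabel-rigid (inj₂ s) (inj₂ s′) _ _ eq _ = cong inj₂ (Finₚ.inject≤-injective _ _ _ _ eq)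
    slotLabel-rigid (inj₂ s) (inj₁ (k , false)) f _ _ _ with () ← f refl
    slotLabel-rigid (inj₂ s) (inj₁ (k , true))  f _ _ _ with () ← f refl
    slotLabel-rigid (inj₁ (k , false)) (inj₂ s) _ f _ _ with () ← f refl
    slotLabel-rigid (inj₁ (k , true))  (inj₂ s) _ f _ _ with () ← f refl
    slotLabel-rigid (inj₁ (k , b)) (inj₁ (l , d)) _ _ eq eq′ =
      rigid b d (Finₚ.inject≤-injective _ _ _ _ eq) (Finₚ.inject≤-injective _ _ _ _ eq′)
      where
      E : Fin i → Bool → Fin p
      E k = endpoint p (inject≤ k i≤pairs)

      E-injective : ∀ {k l} → E k false ≡ E l false → E k true ≡ E l true → k ≡ l
      E-injective eq eq′ = Finₚ.inject≤-injective _ _ _ _ (endpoint-injective p _ _ eq eq′)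

      -- The `false` end carries the smaller label, so a crosswise match would reverse the order.
      -- With `l` equal to `k` this excludes reversing an edge.
      crossed : E l false ≡ E k true → E l true ≢ E k false
      crossed eq eq′ = Finₚ.<-asym (endpoint-< p (inject≤ k i≤pairs))
        (subst₂ Fin._<_ eq eq′ (endpoint-< p (inject≤ l i≤pairs)))

      rigid : ∀ b d → E l d ≡ E k b → E l (not d) ≡ E k (not b) → inj₁ {B = Fin r} (l , d) ≡ inj₁ (k , b)
      rigid false false eq eq′ = cong (λ k → inj₁ (k , false)) (E-injective eq eq′)
      rigid true  true  eq eq′ = cong (λ k → inj₁ (k , true)) (E-injective eq′ eq)
      rigid false true  eq eq′ = contradiction eq (crossed eq′)
      rigid true  false eq eq′ = contradiction eq′ (crossed eq)

    label-rigid : (τ : Automorphism G) → Preserves τ label → IsIdentity τ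
    label-rigid τ pres x = slot-injective (slotLabel-rigid (slot x) (slot (apply τ x))
      (λ eq → trans (sym (slot-partner _)) (cong slot (trans (sym (comm x)) (cong (apply τ) (fixed eq)))))
      (λ eq → trans (sym (slot-partner _)) (cong slot (↔-injective (perm τ) (trans (comm x) (fixed eq)))))
      (pres x)
      (subst₂ (λ v w → slotLabel v ≡ slotLabel w)
        (trans (cong slot (comm x)) (slot-partner _)) (slot-partner x) (pres (partner x))))
      where
      comm = automorphism-partner τ

      fixed : ∀ {y} → mate (slot y) ≡ slot y → partner y ≡ y
      fixed eq = trans (cong vertex eq) (vertex-slot _)

    -- `c` is joined to the whole first copy, and in its own copy it can miss only its partner.
    center-almostDominating : AlmostDominating F (inj₂ c)
    center-almostDominating {inj₁ y} _ _ ¬ay _ = contradiction (g≡c y) ¬ay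
    center-almostDominating {inj₂ y} {inj₁ z} _ _ _ ¬az = contradiction (g≡c z) ¬az
    center-almostDominating {inj₂ y} {inj₂ z} y≢c z≢c ¬ay ¬az = cong inj₂
      (trans (nonneighbour (y≢c ∘ cong inj₂ ∘ sym) ¬ay) (sym (nonneighbour (z≢c ∘ cong inj₂ ∘ sym) ¬az)))

    -- A vertex of the first copy misses all of the second copy but `c`, and a vertex of the second
    -- copy other than `c` misses the whole first copy; each time that is at least two vertices.
    almostDominating⇒center : ∀ x → AlmostDominating F x → x ≡ inj₂ c
    almostDominating⇒center (inj₁ a) dom
      with b , b≢c , _ ← fresh 3≤n c c
      with d , d≢c , d≢b ← fresh 3≤n c b
      = contradiction (inj₂-injective (dom {inj₂ d} {inj₂ b} (λ ()) (λ ()) (apart d≢c) (apart b≢c))) d≢b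
      where
      apart : ∀ {d} → d ≢ c → g a ≢ d
      apart d≢c eq = d≢c (trans (sym eq) (g≡c a))
    almostDominating⇒center (inj₂ b) dom = cong inj₂ (decidable-stable (b Finₚ.≟ c) λ b≢c →
      let d , d≢b , _ = fresh 3≤n b b
          apart : ∀ {x} → g x ≢ b
          apart = λ eq → b≢c (trans (sym eq) (g≡c _))
      in d≢b (inj₁-injective (dom {inj₁ d} {inj₁ b} (λ ()) (λ ()) apart apart)))

    center-fixed : (σ : Automorphism F) → apply σ (inj₂ c) ≡ inj₂ c
    center-fixed σ =
      almostDominating⇒center _ (almostDominating-apply {H = F} σ λ {y} {z} → center-almostDominating {y} {z})

    -- If one vertex of the first copy moved to the second, connectedness would
    -- drag along the whole copy, into the n - 1 vertices other than c.
    module FirstCopy (σ : Automorphism F) {a b} (crosses : apply σ (inj₁ a) ≡ inj₂ b) where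

      spread : ∀ {x y x′} → apply σ (inj₁ x) ≡ inj₂ y → Adj G x x′ → ∃ λ y′ → apply σ (inj₁ x′) ≡ inj₂ y′
      spread {x} {y} {x′} eq adj with apply σ (inj₁ x′) in eq′
      ... | inj₂ y′ = y′ , refl
      -- An edge from `inj₁ d` to `inj₂ y` forces `y` to be `c`, but `inj₂ c` is already the image
      -- of itself.
      ... | inj₁ d  = contradiction
            (↔-injective (perm σ) (trans eq (trans (cong inj₂ y≡c) (sym (center-fixed σ))))) λ ()
        where
        y≡c : y ≡ c
        y≡c = trans (sym (subst₂ (Adj F) eq eq′ (Equivalence.to (adj-pres σ _ _) adj))) (g≡c d)

      all-cross : ∀ x → ∃ λ y → apply σ (inj₁ x) ≡ inj₂ y
      all-cross x with a Finₚ.≟ x | x Finₚ.≟ partner a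
      ... | yes refl | _         = b , crosses
      ... | no a≢x   | no x≢pa   = spread crosses (adjacent a≢x x≢pa)
      ... | no _     | yes refl
        -- The partner of `a` is not adjacent to `a`; it is reached through a third vertex `w`,
        -- adjacent to both.
        with w , w≢a , w≢pa ← fresh 3≤n a (partner a)
        = spread (proj₂ (spread crosses (adjacent (w≢a ∘ sym) w≢pa)))
            (adjacent w≢pa λ eq → w≢a
              (trans (sym (partner-involutive w)) (trans (cong partner (sym eq)) (partner-involutive a))))

      -- The first copy together with `inj₂ c`: `n + 1` vertices that `σ` would map injectively into
      -- the second copy.
      source : Fin (suc n) → Fin n ⊎ Fin n
      source zero    = inj₂ c
      source (suc x) = inj₁ x

      target : Fin (suc n) → Fin n
      target zero    = c
      target (suc x) = proj₁ (all-cross x)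

      source-target : ∀ x → apply σ (source x) ≡ inj₂ (target x)
      source-target zero    = center-fixed σ
      source-target (suc x) = proj₂ (all-cross x)

      source-injective : Injective _≡_ _≡_ source
      source-injective {zero}  {zero}  _    = refl
      source-injective {suc _} {suc _} refl = refl

      impossible : ⊥
      impossible = 1+n≰n (Finₚ.injective⇒≤ {f = target} λ {x} {y} eq → source-injective
        (↔-injective (perm σ) (trans (source-target x) (trans (cong inj₂ eq) (sym (source-target y))))))

    first-preserved : (σ : Automorphism F) → ∀ a → ∃ λ a′ → apply σ (inj₁ a) ≡ inj₁ a′
    first-preserved σ a with apply σ (inj₁ a) in eq
    ... | inj₁ a′ = a′ , refl
    ... | inj₂ _  = ⊥-elim (FirstCopy.impossible σ eq)

    second-preserved : (σ : Automorphism F) → ∀ b → ∃ λ b′ → apply σ (inj₂ b) ≡ inj₂ b′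
    second-preserved σ b with apply σ (inj₂ b) in eq
    ... | inj₂ b′ = b′ , refl
    ... | inj₁ a
      -- The inverse of `σ` keeps `inj₁ a` in the first copy, yet it has to return it to `inj₂ b`.
      with a′ , eq′ ← first-preserved (inverse σ) a
      with () ← trans (sym (Inverse.strictlyInverseʳ (perm σ) (inj₂ b))) (trans (cong (apply (inverse σ)) eq) eq′)

    distinguishing : Distinguishing F [ label , label ]
    distinguishing (σ , σ≢id , pres) = σ≢id λ where
        (inj₁ x) → trans (proj₂ (first-preserved σ x)) (cong inj₁ (label-rigid First.restriction
          (λ y → trans (cong [ label , label ] (sym (proj₂ (first-preserved σ y)))) (pres (inj₁ y))) x))
        (inj₂ x) → trans (proj₂ (second-preserved σ x)) (cong inj₂ (label-rigid Second.restriction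
          (λ y → trans (cong [ label , label ] (sym (proj₂ (second-preserved σ y)))) (pres (inj₂ y))) x))
      where
      module First = Restriction {K = G} {H = F} inj₁ inj₁-injective (λ _ _ → ⇔-id _) σ
        (first-preserved σ) (first-preserved (inverse σ))
      module Second = Restriction {K = G} {H = F} inj₂ inj₂-injective (λ _ _ → ⇔-id _) σ
        (second-preserved σ) (second-preserved (inverse σ))

-- Combining the bounds

phiBound : ∀ {i k} → 1 ≤ i → i ≤ k C 2 → PhiBound i k
-- For `k` below 2 the binomial coefficient is 0, contradicting `1 ≤ i`.
phiBound {k = zero}        1≤i i≤ with () ← ≤-trans 1≤i i≤
phiBound {k = suc zero}    1≤i i≤ with () ← ≤-trans 1≤i i≤
phiBound {k = suc (suc _)} _   i≤ = s≤s (s≤s z≤n) , i≤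

theorem3p4 : (n i : ℕ) → 5 ≤ n → 1 ≤ i → i ≤ ⌊ n /2⌋ →
    (G : Graph (Fin n)) → DeletedFromComplete n i G →
    (g : Fin n → Fin n) → Constant g →
    Dist (functigraph G g) ((n ∸ 2 * i) ⊔ φ i)
theorem3p4 n i 5≤n 1≤i _ G d g (c , g≡c) with coordinates d
-- With `n` replaced by `r + 2 * i`, the term `n ∸ 2 * i` becomes the number `r` of saturated
-- vertices.
... | r , refl , M rewrite m+n∸n≡m r (2 * i) =
      (_ , distinguishing) , λ k (f , dist) → let open LowerBound f dist in
        ⊔-lub free≤ (proj₂ (proj₂ (φ-least i)) k (phiBound 1≤i (subst (i ≤_) (tri≡C2 k) pairs≤)))
  where
  open ConstantFunctigraph M g c g≡c
  open UpperBound (≤-trans (s≤s (s≤s (s≤s z≤n))) 5≤n)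
    (subst (i ≤_) (sym (tri≡C2 (φ i))) (proj₂ (proj₁ (proj₂ (φ-least i)))))
    (m≤n⊔m r (φ i)) (m≤m⊔n r (φ i))
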